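{- Let $c$ be a positive integer, let $A_1\in\mathcal{D}(E_c)$, and put $B_{A_1,c}:=\frac{1}{A_1}\left(X_{A_1,c}(0)^2+c\right)$. Then: (1) The set $\mathcal{B}_{A_1,c}:=\left(\frac{1}{A_1}E_c\right)\cap\mathbb{N}$ contains, for each $\varepsilon\in\{1,-1\}$, the progression $$\mathcal{B}_{A_1,c,\varepsilon}=\left\{4n\left(A_1n+\varepsilon X_{A_1,c}(0)\right)+B_{A_1,c} : n\in\mathbb{N}\right\}.$$ (2) If $A_1\in E_c$, then $B_{A_1,c}=1$. (3) For each $\varepsilon\in\{1,-1\}$, the polynomial $4n\left(A_1n+\varepsilon X_{A_1,c}(0)\right)+B_{A_1,c}$ in the indeterminate $n$ is an irreducible element of $\mathbb{Z}[n]$ if and only if $\gcd(A_1,X_{A_1,c}(0),B_{A_1,c})=1$.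
   Context: $\mathbb{N}$ includes $0$. For a positive integer $c$, $E_c=\{\xi^2+c : \xi\in\mathbb{Z},\ \xi\equiv c-1 \pmod 2\}$. $\mathcal{D}(E_c)$ is the set of positive integers dividing at least one element of $E_c$. For $A\in\mathcal{D}(E_c)$, $X_{A,c}(0)$ denotes the smallest integer $X\ge 0$ with $X\equiv c-1\pmod 2$ such that $A\mid X^2+c$. $\frac{1}{A_1}E_c=\{e/A_1 : e\in E_c\}$. -}

module Defs where

open import Level using (0ℓ)
open import Algebra.Bundles using (RawSemiring)
open import Data.Integer.Base using (ℤ; +_; -[1+_]; 0ℤ; 1ℤ; -_; ∣_∣; _+_; _-_; _*_)
import Data.Integer.Properties as ℤ
import Data.Integer.Tactic.RingSolver as ℤ-Solver
open import Data.Integer.Divisibility.Signed using (_∣_; _∣?_; divides; ∣⇒∣ᵤ)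
open import Data.List.Base using (List; []; _∷_; map)
open import Data.Nat.Base as ℕ using (ℕ; zero; suc; NonZero; _≤_; z≤n; s≤s)
import Data.Nat.DivMod as ℕ
import Data.Nat.Divisibility as ℕ
open import Data.Product.Base using (∃; _×_; _,_; proj₁; proj₂)
open import Data.Rational.Base using (ℚ; _/_)
open import Function.Base using (_∘_)
open import Relation.Binary.PropositionalEquality using (_≡_; refl; trans; cong; subst; sym)
open import Relation.Nullary using (yes; no; contradiction)
open import Relation.Nullary.Decidable using (_×-dec_)
open import Relation.Unary using (Pred; Decidable; _∈_; _∩_)

infix 4 _≡_[mod_]
_≡_[mod_] : ℤ → ℤ → ℤ → Set
a ≡ b [mod m ] = m ∣ a - b

E : ℕ → Pred ℤ 0ℓ
E c e = ∃ λ ξ → ξ ≡ + c - 1ℤ [mod + 2 ] × e ≡ ξ * ξ + + c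

𝓓 : ℕ → Pred ℕ 0ℓ
𝓓 c A = NonZero A × ∃ λ e → e ∈ E c × + A ∣ e

IsLeast : Pred ℕ 0ℓ → ℕ → Set
IsLeast P m = m ∈ P × (∀ {k} → k ∈ P → m ≤ k)

least : ∀ {P : Pred ℕ 0ℓ} → Decidable P → ∀ n → n ∈ P → ∃ (IsLeast P)
least P? zero    p = 0 , p , λ _ → z≤n
least {P} P? (suc n) p with P? 0
... | yes p₀ = 0 , p₀ , λ _ → z≤n
... | no ¬p₀ with least (P? ∘ suc) n p
...   | m , pm , m-min = suc m , pm , λ {k} → bound k
  where
  bound : ∀ k → k ∈ P → suc m ≤ k
  bound zero    p₀ = contradiction p₀ ¬p₀
  bound (suc k) pk = s≤s (m-min pk)

Admissible : ℕ → ℕ → Pred ℕ 0ℓ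
Admissible c A X = + X ≡ + c - 1ℤ [mod + 2 ] × + A ∣ + X * + X + + c

admissible? : ∀ c A → Decidable (Admissible c A)
admissible? c A X = (+ 2 ∣? _) ×-dec (+ A ∣? _)

admissible-exists : ∀ c A → A ∈ 𝓓 c → ∃ (Admissible c A)
admissible-exists c A (_ , _ , (+ n , par , refl) , A∣e) = n , par , A∣e
admissible-exists c A (_ , _ , (-[1+ n ] , divides q eq , refl) , A∣e) =
  suc n , divides (q + + suc n) (step (+ suc n) (+ c - 1ℤ) q eq) , A∣e
  where
  regroup : ∀ x r → x - r ≡ (- x - r) + x * + 2
  regroup = ℤ-Solver.solve-∀
  step : ∀ x r q → - x - r ≡ q * + 2 → x - r ≡ (q + x) * + 2
  step x r q eq = trans (regroup x r)
    (trans (cong (_+ x * + 2) eq) (sym (ℤ.*-distribʳ-+ (+ 2) q x)))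

module _ (c A : ℕ) (A∈𝓓 : A ∈ 𝓓 c) where

  private instance
    A≢0 : NonZero A
    A≢0 = proj₁ A∈𝓓

  private
    X₀-spec : ∃ (IsLeast (Admissible c A))
    X₀-spec with admissible-exists c A A∈𝓓
    ... | n , p = least (admissible? c A) n p

  X₀ : ℕ
  X₀ = proj₁ X₀-spec

  X₀-isLeast : IsLeast (Admissible c A) X₀
  X₀-isLeast = proj₂ X₀-spec

  -- The truncating division is exact, see B-exact.
  B : ℕ
  B = (X₀ ℕ.* X₀ ℕ.+ c) ℕ./ A

  B-exact : B ℕ.* A ≡ X₀ ℕ.* X₀ ℕ.+ c
  B-exact = ℕ.m/n*n≡m (subst (λ z → A ℕ.∣ ∣ z + + c ∣)
    (sym (ℤ.pos-* X₀ X₀)) (∣⇒∣ᵤ (proj₂ (proj₁ X₀-isLeast))))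

  1/A·_ : Pred ℤ 0ℓ → Pred ℚ 0ℓ
  (1/A· S) q = ∃ λ e → e ∈ S × q ≡ e / A

  ℕ⊂ℚ : Pred ℚ 0ℓ
  ℕ⊂ℚ q = ∃ λ (n : ℕ) → q ≡ + n / 1

  𝓑 : Pred ℚ 0ℓ
  𝓑 = (1/A· E c) ∩ ℕ⊂ℚ

  𝓑-prog : ℤ → Pred ℚ 0ℓ
  𝓑-prog ε q = ∃ λ (n : ℕ) →
    q ≡ (+ 4 * + n * (+ A * + n + ε * + X₀) + + B) / 1

-- ℤ[n] as coefficient lists, constant term first; trailing zeros are
-- allowed, so equality is equality of all coefficients.
Poly : Set
Poly = List ℤ

coeff : Poly → ℕ → ℤ
coeff []      _       = 0ℤ
coeff (a ∷ p) zero    = a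
coeff (a ∷ p) (suc k) = coeff p k

infix  4 _≈ₚ_
infixl 6 _+ₚ_
infixl 7 _*ₚ_

_≈ₚ_ : Poly → Poly → Set
p ≈ₚ q = ∀ k → coeff p k ≡ coeff q k

_+ₚ_ : Poly → Poly → Poly
[]      +ₚ q       = q
(a ∷ p) +ₚ []      = a ∷ p
(a ∷ p) +ₚ (b ∷ q) = (a + b) ∷ (p +ₚ q)

_*ₚ_ : Poly → Poly → Poly
[]      *ₚ q = []
(a ∷ p) *ₚ q = map (a *_) q +ₚ (0ℤ ∷ p *ₚ q)

const : ℤ → Poly
const a = a ∷ []

indet : Poly
indet = 0ℤ ∷ 1ℤ ∷ []

ℤ[n] : RawSemiring 0ℓ 0ℓ
ℤ[n] = record
  { Carrier = Poly
  ; _≈_     = _≈ₚ_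
  ; _+_     = _+ₚ_
  ; _*_     = _*ₚ_
  ; 0#      = []
  ; 1#      = const 1ℤ
  }

𝓑-poly : (c A : ℕ) → A ∈ 𝓓 c → ℤ → Poly
𝓑-poly c A A∈𝓓 ε =
  const (+ 4) *ₚ indet *ₚ (const (+ A) *ₚ indet +ₚ const (ε * + X₀ c A A∈𝓓))
    +ₚ const (+ B c A A∈𝓓)

{-# OPTIONS --safe #-}
-- With X = X₀ and B as in the statement, completing the square gives
-- A₁ (4 n (A₁ n + ε X) + B) = (2 A₁ n + ε X)² + c, whence (1). In (3) the
-- quadratic has discriminant 16 (X² − A₁ B) = −16 c < 0, so it is not a
-- product of two linear polynomials; hence it is irreducible over ℤ iff it
-- is primitive. Its content is gcd (A₁ , X , B), since X ≡ c − 1 (mod 2)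
-- makes A₁ B = X² + c, and with it B, odd.
module Submission where

open import Defs
open import Algebra.Definitions.RawSemiring ℤ[n] using (Irreducible)
import Algebra.Definitions.RawSemiring ℤ[n] as ℤ[n]
open import Algebra.Bundles using (module RawSemiring)
open import Algebra.Definitions.RawMagma (RawSemiring.*-rawMagma ℤ[n]) using (_,_)
open import Data.Integer.Base using (ℤ; +_; -[1+_]; 0ℤ; 1ℤ; -1ℤ; -_; _+_; _-_; _*_; _<_; +≤+; -<+)
import Data.Integer.Base as ℤ
import Data.Integer.Properties as ℤ
import Data.Integer.Tactic.RingSolver as ℤ-Solver
open import Data.Integer.Divisibility.Signed
  using (_∣_; divides; ∣ᵤ⇒∣; ∣⇒∣ᵤ; ∣-reflexive; ∣m⇒∣m*n; ∣n⇒∣m*n; ∣m∣n⇒∣m-n)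
open import Data.List.Base using ([]; _∷_; map)
open import Data.Nat.Base as ℕ using (ℕ; NonZero; zero; suc; s≤s; z≤n; s<s)
import Data.Nat.Divisibility as ℕ
open import Data.Nat.GCD using (gcd; gcd[m,n]∣m; gcd[m,n]∣n; gcd-greatest)
import Data.Nat.Properties as ℕ
open import Data.Product.Base using (_×_; _,_; ∃; proj₁; proj₂)
open import Data.Rational.Base using (_/_)
open import Data.Rational.Properties using (fromℚᵘ-cong)
open import Data.Rational.Unnormalised.Base using (mkℚᵘ; *≡*)
open import Data.Sum.Base using (_⊎_; inj₁; inj₂; [_,_]′)
open import Function.Base using (_∘_)
open import Function.Bundles using (_⇔_; mk⇔)
open import Relation.Binary.PropositionalEquality
  using (_≡_; _≢_; refl; sym; trans; cong; cong₂; subst; module ≡-Reasoning)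
open import Relation.Nullary using (yes; no; contradiction)
open import Relation.Unary using (_∈_; _⊆_)

-- Squares and zero divisors in the integers.

0≤i² : ∀ i → 0ℤ ℤ.≤ i * i
0≤i² (+ zero)  = +≤+ z≤n
0≤i² (+ suc _) = +≤+ z≤n
0≤i² -[1+ _ ]  = +≤+ z≤n

i≢0∧j≢0⇒i*j≢0 : ∀ {i j} → i ≢ 0ℤ → j ≢ 0ℤ → i * j ≢ 0ℤ
i≢0∧j≢0⇒i*j≢0 {i} i≢0 j≢0 = [ i≢0 , j≢0 ]′ ∘ ℤ.i*j≡0⇒i≡0∨j≡0 i

-- Coefficients of sums and products of polynomials.

coeff-+ₚ : ∀ p q k → coeff (p +ₚ q) k ≡ coeff p k + coeff q k
coeff-+ₚ []      q       k       = sym (ℤ.+-identityˡ _)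
coeff-+ₚ (a ∷ p) []      k       = sym (ℤ.+-identityʳ _)
coeff-+ₚ (a ∷ p) (b ∷ q) zero    = refl
coeff-+ₚ (a ∷ p) (b ∷ q) (suc k) = coeff-+ₚ p q k

coeff-map-* : ∀ a q k → coeff (map (a *_) q) k ≡ a * coeff q k
coeff-map-* a []      k       = sym (ℤ.*-zeroʳ a)
coeff-map-* a (b ∷ q) zero    = refl
coeff-map-* a (b ∷ q) (suc k) = coeff-map-* a q k

coeff-∷-* : ∀ a p q k → coeff ((a ∷ p) *ₚ q) k ≡ a * coeff q k + coeff (0ℤ ∷ p *ₚ q) k
coeff-∷-* a p q k = trans (coeff-+ₚ (map (a *_) q) _ k)
  (cong (_+ coeff (0ℤ ∷ p *ₚ q) k) (coeff-map-* a q k))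

-- Degrees, constant factors and leading coefficients.

VanishesAbove : ℕ → Poly → Set
VanishesAbove d p = ∀ {k} → d ℕ.< k → coeff p k ≡ 0ℤ

-- Read off the coefficients and not the list length, since a list may end in zeros. The zero
-- polynomial has no degree in this sense.
HasDegree : ℕ → Poly → Set
HasDegree d p = coeff p d ≢ 0ℤ × VanishesAbove d p

∷-constant : ∀ {a p} → coeff p 0 ≡ 0ℤ → VanishesAbove 0 p → VanishesAbove 0 (a ∷ p)
∷-constant p₀≡0 vanish {suc zero}    _ = p₀≡0
∷-constant p₀≡0 vanish {suc (suc k)} _ = vanish (s≤s z≤n)

-- The zero polynomial counts as constant, so the other case always has a degree of the form
-- `suc d`.
constant⊎positiveDegree : ∀ p → VanishesAbove 0 p ⊎ ∃ λ d → HasDegree (suc d) p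
constant⊎positiveDegree []      = inj₁ λ _ → refl
constant⊎positiveDegree (a ∷ p) with constant⊎positiveDegree p
... | inj₂ (d , lead , vanish) = inj₂ (suc d , lead , λ where (s<s d<k) → vanish d<k)
-- Over a constant tail, `a ∷ p` is linear or constant according to whether the constant term of `p`
-- is nonzero.
... | inj₁ vanish with coeff p 0 ℤ.≟ 0ℤ
...   | no  lead = inj₂ (0 , lead , λ where (s<s 0<k) → vanish 0<k)
...   | yes p₀≡0 = inj₁ (∷-constant p₀≡0 vanish)

-- The tail of a constant list may still consist of zeros. Its constant term is 0, so by induction
-- its product with `q` contributes nothing.
coeff-*-constantˡ : ∀ p q → VanishesAbove 0 p → ∀ k → coeff (p *ₚ q) k ≡ coeff p 0 * coeff q k
coeff-*-constantˡ []      q vanish k       = sym (ℤ.*-zeroˡ (coeff q k))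
coeff-*-constantˡ (a ∷ p) q vanish zero    = trans (coeff-∷-* a p q 0) (ℤ.+-identityʳ _)
coeff-*-constantˡ (a ∷ p) q vanish (suc k) = begin
  coeff ((a ∷ p) *ₚ q) (suc k)             ≡⟨ coeff-∷-* a p q (suc k) ⟩
  a * coeff q (suc k) + coeff (p *ₚ q) k   ≡⟨ cong (_+_ (a * coeff q (suc k))) p*q≡0 ⟩
  a * coeff q (suc k) + 0ℤ                 ≡⟨ ℤ.+-identityʳ _ ⟩
  a * coeff q (suc k)                      ∎
  where
  open ≡-Reasoning
  p*q≡0 : coeff (p *ₚ q) k ≡ 0ℤ
  p*q≡0 = trans (coeff-*-constantˡ p q (vanish ∘ ℕ.m<n⇒m<1+n) k)
    (trans (cong (_* coeff q k) (vanish (s≤s z≤n))) (ℤ.*-zeroˡ (coeff q k)))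

-- Induction on `p`: the summand `a * q` contributes nothing in degree `suc (d + e)`, which exceeds
-- `e`. Only upper bounds on the degrees enter, so either top coefficient may be zero.
coeff-*-leading : ∀ p q {d e} → VanishesAbove d p → VanishesAbove e q →
  coeff (p *ₚ q) (d ℕ.+ e) ≡ coeff p d * coeff q e
coeff-*-leading []      q {e = e} vp vq = sym (ℤ.*-zeroˡ (coeff q e))
coeff-*-leading (a ∷ p) q {zero}  vp vq = coeff-*-constantˡ (a ∷ p) q vp _
coeff-*-leading (a ∷ p) q {suc d} {e} vp vq = begin
  coeff ((a ∷ p) *ₚ q) (suc (d ℕ.+ e))                     ≡⟨ coeff-∷-* a p q _ ⟩
  a * coeff q (suc (d ℕ.+ e)) + coeff (p *ₚ q) (d ℕ.+ e)   ≡⟨ cong₂ _+_ a*q≡0 IH ⟩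
  0ℤ + coeff p d * coeff q e                               ≡⟨ ℤ.+-identityˡ _ ⟩
  coeff p d * coeff q e                                    ∎
  where
  open ≡-Reasoning
  IH : coeff (p *ₚ q) (d ℕ.+ e) ≡ coeff p d * coeff q e
  IH = coeff-*-leading p q (vp ∘ s<s) vq
  a*q≡0 : a * coeff q (suc (d ℕ.+ e)) ≡ 0ℤ
  a*q≡0 = trans (cong (a *_) (vq (s≤s (ℕ.m≤n+m e d)))) (ℤ.*-zeroʳ a)

coeff-*-constantʳ : ∀ p q → VanishesAbove 0 q → ∀ k → coeff (p *ₚ q) k ≡ coeff p k * coeff q 0
coeff-*-constantʳ []      q vanish k       = sym (ℤ.*-zeroˡ (coeff q 0))
coeff-*-constantʳ (a ∷ p) q vanish zero    = trans (coeff-∷-* a p q 0) (ℤ.+-identityʳ _)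
coeff-*-constantʳ (a ∷ p) q vanish (suc k) = begin
  coeff ((a ∷ p) *ₚ q) (suc k)             ≡⟨ coeff-∷-* a p q (suc k) ⟩
  a * coeff q (suc k) + coeff (p *ₚ q) k   ≡⟨ cong₂ _+_ a*q≡0 (coeff-*-constantʳ p q vanish k) ⟩
  0ℤ + coeff p k * coeff q 0               ≡⟨ ℤ.+-identityˡ _ ⟩
  coeff p k * coeff q 0                    ∎
  where
  open ≡-Reasoning
  a*q≡0 : a * coeff q (suc k) ≡ 0ℤ
  a*q≡0 = trans (cong (a *_) (vanish (s≤s z≤n))) (ℤ.*-zeroʳ a)

coeff-*-0 : ∀ p q → coeff (p *ₚ q) 0 ≡ coeff p 0 * coeff q 0
coeff-*-0 []      q = sym (ℤ.*-zeroˡ (coeff q 0))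
coeff-*-0 (a ∷ p) q = trans (coeff-∷-* a p q 0) (ℤ.+-identityʳ _)

coeff-*-1 : ∀ p q → coeff (p *ₚ q) 1 ≡ coeff p 0 * coeff q 1 + coeff p 1 * coeff q 0
coeff-*-1 []      q = sym (cong₂ _+_ (ℤ.*-zeroˡ (coeff q 1)) (ℤ.*-zeroˡ (coeff q 0)))
coeff-*-1 (a ∷ p) q = trans (coeff-∷-* a p q 1) (cong (_+_ (a * coeff q 1)) (coeff-*-0 p q))

-- Units of the polynomial ring.

const-vanishes : ∀ u → VanishesAbove 0 (const u)
const-vanishes u (s≤s _) = refl

constantUnit : ∀ x → VanishesAbove 0 x → coeff x 0 ∣ 1ℤ → x ℤ[n].∣ const 1ℤ
constantUnit x vanish (divides u 1≡u*x₀) = const u , λ where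
  zero    → trans (coeff-*-constantˡ (const u) x (const-vanishes u) 0) (sym 1≡u*x₀)
  (suc k) → trans (coeff-*-constantˡ (const u) x (const-vanishes u) (suc k))
    (trans (cong (u *_) (vanish (s≤s z≤n))) (ℤ.*-zeroʳ u))

-- The integers have no zero divisors, so a product `q *ₚ p` equal to 1 would have a nonzero
-- coefficient in positive degree. For constant `q` this needs `q` nonzero, which the constant term
-- of the product supplies.
positiveDegree⇒∤1 : ∀ {p d} → HasDegree (suc d) p → p ℤ[n].∤ const 1ℤ
positiveDegree⇒∤1 {p} {d} (lead , vanish) (q , q*p≈1) with constant⊎positiveDegree q
... | inj₂ (e , q-lead , q-vanish) = i≢0∧j≢0⇒i*j≢0 q-lead lead
  (trans (sym (coeff-*-leading q p q-vanish vanish)) (q*p≈1 _))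
... | inj₁ q-vanish = i≢0∧j≢0⇒i*j≢0 q₀≢0 lead
  (trans (sym (coeff-*-constantˡ q p q-vanish (suc d))) (q*p≈1 (suc d)))
  where
  q₀≢0 : coeff q 0 ≢ 0ℤ
  q₀≢0 q₀≡0 = contradiction 0≡1 λ ()
    where
    open ≡-Reasoning
    0≡1 : 0ℤ ≡ 1ℤ
    0≡1 = begin
      0ℤ                      ≡⟨ ℤ.*-zeroˡ (coeff p 0) ⟨
      0ℤ * coeff p 0          ≡⟨ cong (_* coeff p 0) q₀≡0 ⟨
      coeff q 0 * coeff p 0   ≡⟨ coeff-*-0 q p ⟨
      coeff (q *ₚ p) 0        ≡⟨ q*p≈1 0 ⟩
      1ℤ                      ∎

-- Quadratics: primitivity, discriminant and irreducibility.

quadratic : ℤ → ℤ → ℤ → Poly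
quadratic a b e = e ∷ b ∷ a ∷ []

-- Content one, phrased through common divisors: a constant factor of a quadratic is exactly such a
-- divisor.
Primitive : ℤ → ℤ → ℤ → Set
Primitive a b e = ∀ {g} → g ∣ a → g ∣ b → g ∣ e → g ∣ 1ℤ

quadratic-vanishes : ∀ a b e → VanishesAbove 2 (quadratic a b e)
quadratic-vanishes a b e {suc (suc (suc _))} _ = refl
quadratic-vanishes a b e {suc zero} (s<s ())
quadratic-vanishes a b e {suc (suc zero)} (s<s (s<s ()))

module _ {a b e} (f : Poly) (f≈ : f ≈ₚ quadratic a b e) where

  quadratic-degree : a ≢ 0ℤ → HasDegree 2 f
  quadratic-degree a≢0 =
    a≢0 ∘ trans (sym (f≈ 2)) , λ {k} 2<k → trans (f≈ k) (quadratic-vanishes a b e 2<k)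

  -- A common divisor `g` gives the factorisation of `f` into `const g` and `f′`. The cofactor still
  -- has degree 2, hence is no unit, so irreducibility makes `g` one.
  irreducible⇒primitive : a ≢ 0ℤ → Irreducible f → Primitive a b e
  irreducible⇒primitive a≢0 irr {g} (divides a′ a≡) (divides b′ b≡) (divides e′ e≡) =
    [ g∣1 , (λ f′∣1 → contradiction f′∣1 f′∤1) ]′
      (ℤ[n].Irreducible.split-∣1 irr {const g} {f′} f≈g*f′)
    where
    f′ = quadratic a′ b′ e′
    f≈g*f′ : f ≈ₚ const g *ₚ f′
    f≈g*f′ k = trans (f≈ k)
      (trans (scaled k) (sym (coeff-*-constantˡ (const g) f′ (const-vanishes g) k)))
      where
      scaled : ∀ k → coeff (quadratic a b e) k ≡ g * coeff f′ k
      scaled 0                   = trans e≡ (ℤ.*-comm e′ g)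
      scaled 1                   = trans b≡ (ℤ.*-comm b′ g)
      scaled 2                   = trans a≡ (ℤ.*-comm a′ g)
      scaled (suc (suc (suc _))) = sym (ℤ.*-zeroʳ g)
    g∣1 : const g ℤ[n].∣ const 1ℤ → g ∣ 1ℤ
    g∣1 (u , u*g≈1) = divides (coeff u 0) (trans (sym (u*g≈1 0)) (coeff-*-0 u (const g)))
    a′≢0 : a′ ≢ 0ℤ
    a′≢0 a′≡0 = a≢0 (trans a≡ (trans (cong (_* g) a′≡0) (ℤ.*-zeroˡ g)))
    f′∤1 : f′ ℤ[n].∤ const 1ℤ
    f′∤1 = positiveDegree⇒∤1 (a′≢0 , quadratic-vanishes a′ b′ e′)

  -- The discriminant of a product of two linear polynomials is the square of their resultant
  -- `x₀ * y₁ - x₁ * y₀`.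
  linearFactors⇒0≤disc : ∀ x y → VanishesAbove 1 x → VanishesAbove 1 y → f ≈ₚ x *ₚ y →
    0ℤ ℤ.≤ b * b - + 4 * a * e
  linearFactors⇒0≤disc x y vx vy f≈xy = subst (0ℤ ℤ.≤_) eq (0≤i² (x₀ * y₁ - x₁ * y₀))
    where
    x₀ = coeff x 0
    x₁ = coeff x 1
    y₀ = coeff y 0
    y₁ = coeff y 1
    square : ∀ x₀ x₁ y₀ y₁ → (x₀ * y₁ - x₁ * y₀) * (x₀ * y₁ - x₁ * y₀) ≡
      (x₀ * y₁ + x₁ * y₀) * (x₀ * y₁ + x₁ * y₀) - + 4 * (x₁ * y₁) * (x₀ * y₀)
    square = ℤ-Solver.solve-∀
    a≡ : a ≡ x₁ * y₁
    a≡ = trans (sym (f≈ 2)) (trans (f≈xy 2) (coeff-*-leading x y vx vy))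
    b≡ : b ≡ x₀ * y₁ + x₁ * y₀
    b≡ = trans (sym (f≈ 1)) (trans (f≈xy 1) (coeff-*-1 x y))
    e≡ : e ≡ x₀ * y₀
    e≡ = trans (sym (f≈ 0)) (trans (f≈xy 0) (coeff-*-0 x y))
    eq : (x₀ * y₁ - x₁ * y₀) * (x₀ * y₁ - x₁ * y₀) ≡ b * b - + 4 * a * e
    eq = trans (square x₀ x₁ y₀ y₁) (sym
      (cong₂ _-_ (cong₂ _*_ b≡ b≡) (cong₂ (λ a e → + 4 * a * e) a≡ e≡)))

  module _ (disc<0 : b * b - + 4 * a * e < 0ℤ) where

    -- For `a` zero the discriminant would be the square `b * b`.
    leading≢0 : a ≢ 0ℤ
    leading≢0 refl = ℤ.<⇒≱ disc<0 (subst (0ℤ ℤ.≤_) (disc b e) (0≤i² b))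
      where
      disc : ∀ b e → b * b ≡ b * b - + 4 * 0ℤ * e
      disc = ℤ-Solver.solve-∀

    -- A constant factor divides all three coefficients and is a unit by primitivity. Two factors of
    -- positive degree must both be linear, which the negative discriminant forbids.
    primitive⇒irreducible : Primitive a b e → Irreducible f
    primitive⇒irreducible prim = ℤ[n].mkIrred
      (positiveDegree⇒∤1 (quadratic-degree leading≢0)) split
      where
      dividesAll : ∀ g (h : Poly) → (∀ k → coeff f k ≡ coeff h k * g) → g ∣ 1ℤ
      dividesAll g h eq = prim (at 2) (at 1) (at 0)
        where
        at : ∀ k → g ∣ coeff (quadratic a b e) k
        at k = divides (coeff h k) (trans (sym (f≈ k)) (eq k))

      split : ∀ {x y} → f ≈ₚ x *ₚ y → x ℤ[n].∣ const 1ℤ ⊎ y ℤ[n].∣ const 1ℤ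
      split {x} {y} f≈xy with constant⊎positiveDegree x | constant⊎positiveDegree y
      ... | inj₁ vx | _ = inj₁ (constantUnit x vx (dividesAll (coeff x 0) y λ k →
        trans (f≈xy k) (trans (coeff-*-constantˡ x y vx k) (ℤ.*-comm (coeff x 0) _))))
      ... | inj₂ _ | inj₁ vy = inj₂ (constantUnit y vy (dividesAll (coeff y 0) x λ k →
        trans (f≈xy k) (coeff-*-constantʳ x y vy k)))
      -- The degrees are `suc i` and `suc j`. If their sum exceeded 2, the nonzero product of the
      -- leading coefficients would be a coefficient of `f` above degree 2.
      ... | inj₂ (i , lx , vx) | inj₂ (j , ly , vy) = linear i j vx vy (ℕ.≮⇒≥ λ 2<i+j →
        i≢0∧j≢0⇒i*j≢0 lx ly (trans (sym (coeff-*-leading x y vx vy))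
          (trans (sym (f≈xy _)) (proj₂ (quadratic-degree leading≢0) 2<i+j))))
        where
        linear : ∀ i j → VanishesAbove (suc i) x → VanishesAbove (suc j) y →
          suc i ℕ.+ suc j ℕ.≤ 2 → x ℤ[n].∣ const 1ℤ ⊎ y ℤ[n].∣ const 1ℤ
        linear zero zero vx vy _ =
          contradiction (linearFactors⇒0≤disc x y vx vy f≈xy) (ℤ.<⇒≱ disc<0)
        linear zero    (suc j) _ _ (s≤s (s≤s ()))
        linear (suc i) j       _ _ (s≤s (s≤s i+1+j≤0)) =
          contradiction (ℕ.≤-trans (ℕ.m≤n+m (suc j) i) i+1+j≤0) λ ()

-- Parity arguments and exact fractions.

square-suc-even : ∀ n → + 2 ∣ + n * (1ℤ + + n)
square-suc-even zero    = divides 0ℤ refl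
square-suc-even (suc n) with divides q eq ← square-suc-even n =
  divides (q + (1ℤ + + n)) (trans (shift (+ n)) (trans (cong (_+ (1ℤ + + n) * + 2) eq)
    (sym (ℤ.*-distribʳ-+ (+ 2) q (1ℤ + + n)))))
  where
  shift : ∀ x → (1ℤ + x) * (1ℤ + (1ℤ + x)) ≡ x * (1ℤ + x) + (1ℤ + x) * + 2
  shift = ℤ-Solver.solve-∀

-- `X² + c - 1` is the difference of `X (X + 1)` and `X - (c - 1)`, both even.
admissible⇒odd : ∀ {c A X} → Admissible c A X → + 2 ∣ + X * + X + + c - 1ℤ
admissible⇒odd {c} {A} {X} (divides q X-c≡ , _) with divides h X²+X≡ ← square-suc-even X =
  divides (h - q) (trans (regroup (+ X) (+ c)) (trans (cong₂ _-_ X²+X≡ X-c≡) (factor h q)))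
  where
  regroup : ∀ x c → x * x + c - 1ℤ ≡ x * (1ℤ + x) - (x - (c - 1ℤ))
  regroup = ℤ-Solver.solve-∀
  factor : ∀ h q → h * + 2 - q * + 2 ≡ (h - q) * + 2
  factor = ℤ-Solver.solve-∀

-- From s = 2 m + 1 one gets s² = 4 (m² + m) + 1, so z = s² z − 4 (m² + m) z.
odd-cancel-4 : ∀ {g s z} → + 2 ∣ s - 1ℤ → g ∣ s → g ∣ + 4 * z → g ∣ z
odd-cancel-4 {g} {s} {z} (divides m s-1≡) g∣s g∣4z =
  subst (g ∣_) (trans (cong (λ s → s * (s * z) - (m * m + m) * (+ 4 * z)) s≡) (identity m z))
    (∣m∣n⇒∣m-n (∣m⇒∣m*n (s * z) g∣s) (∣n⇒∣m*n (m * m + m) g∣4z))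
  where
  s≡ : s ≡ m * + 2 + 1ℤ
  s≡ = trans (add-sub s) (cong (_+ 1ℤ) s-1≡)
    where
    add-sub : ∀ s → s ≡ s - 1ℤ + 1ℤ
    add-sub = ℤ-Solver.solve-∀
  identity : ∀ m z → (m * + 2 + 1ℤ) * ((m * + 2 + 1ℤ) * z) - (m * m + m) * (+ 4 * z) ≡ z
  identity = ℤ-Solver.solve-∀

-- Equality is proved for unnormalised fractions, where it is cross-multiplication, and then
-- transported. The second field of `mkℚᵘ` is the denominator minus one.
i≡j*n⇒j/1≡i/n : ∀ i j n .{{_ : NonZero n}} → j * + n ≡ i → j / 1 ≡ i / n
i≡j*n⇒j/1≡i/n i j (suc n) j*n≡i = fromℚᵘ-cong {mkℚᵘ j 0} {mkℚᵘ i n}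
  (*≡* (trans j*n≡i (sym (ℤ.*-identityʳ i))))

ε²≡1 : ∀ {ε} → ε ≡ 1ℤ ⊎ ε ≡ -1ℤ → ε * ε ≡ 1ℤ
ε²≡1 (inj₁ refl) = refl
ε²≡1 (inj₂ refl) = refl

-- The progression, its polynomial and the value of `B`.

module _ (c A : ℕ) (A∈𝓓 : A ∈ 𝓓 c) where

  private
    X = X₀ c A A∈𝓓
    b = B c A A∈𝓓

    instance
      A≢0 : NonZero A
      A≢0 = proj₁ A∈𝓓

  B-exact-ℤ : + b * + A ≡ + X * + X + + c
  B-exact-ℤ = begin
    + b * + A           ≡⟨ ℤ.pos-* b A ⟨
    + (b ℕ.* A)         ≡⟨ cong +_ (B-exact c A A∈𝓓) ⟩
    + (X ℕ.* X) + + c   ≡⟨ cong (_+ + c) (ℤ.pos-* X X) ⟩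
    + X * + X + + c     ∎
    where open ≡-Reasoning

  odd-X²+c : + 2 ∣ + X * + X + + c - 1ℤ
  odd-X²+c = admissible⇒odd {c} {A} {X} (proj₁ (X₀-isLeast c A A∈𝓓))

  module _ (ε : ℤ) (ε≡±1 : ε ≡ 1ℤ ⊎ ε ≡ -1ℤ) where

    private
      ε² : ε * ε ≡ 1ℤ
      ε² = ε²≡1 ε≡±1

    progression⊆𝓑 : 𝓑-prog c A A∈𝓓 ε ⊆ 𝓑 c A A∈𝓓
    progression⊆𝓑 (n , q≡v) =
      (e , (ξ , parity ε≡±1 , refl) , trans q≡v v≡e/A) ,
      ℤ.∣ v ∣ , trans q≡v (cong (_/ 1) (sym (ℤ.0≤i⇒+∣i∣≡i 0≤v)))
      where
      v = + 4 * + n * (+ A * + n + ε * + X) + + b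
      ξ = + 2 * + A * + n + ε * + X
      e = ξ * ξ + + c

      parity : ε ≡ 1ℤ ⊎ ε ≡ -1ℤ → ξ ≡ + c - 1ℤ [mod + 2 ]
      parity ε≡ with divides h X-c≡ ← proj₁ (proj₁ (X₀-isLeast c A A∈𝓓)) | ε≡
      ... | inj₁ refl = divides (+ A * + n + h) (trans (regroup (+ A) (+ n) (+ X) (+ c))
        (trans (cong (_+_ (+ 2 * + A * + n)) X-c≡) (factor (+ A) (+ n) h)))
        where
        regroup : ∀ A n X c → + 2 * A * n + 1ℤ * X - (c - 1ℤ) ≡ + 2 * A * n + (X - (c - 1ℤ))
        regroup = ℤ-Solver.solve-∀
        factor : ∀ A n h → + 2 * A * n + h * + 2 ≡ (A * n + h) * + 2
        factor = ℤ-Solver.solve-∀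
      -- Replacing `X` by `- X` changes `ξ` by the even number `2 X`, which the quotient absorbs.
      ... | inj₂ refl = divides (+ A * + n - + X + h) (trans (regroup (+ A) (+ n) (+ X) (+ c))
        (trans (cong (_+_ (+ 2 * (+ A * + n - + X))) X-c≡) (factor (+ A * + n - + X) h)))
        where
        regroup : ∀ A n X c → + 2 * A * n + -1ℤ * X - (c - 1ℤ) ≡ + 2 * (A * n - X) + (X - (c - 1ℤ))
        regroup = ℤ-Solver.solve-∀
        factor : ∀ y h → + 2 * y + h * + 2 ≡ (y + h) * + 2
        factor = ℤ-Solver.solve-∀

      -- Completing the square leaves `- ε² X²`, which cancels the `X²` in `b * A`.
      v*A≡e : v * + A ≡ e
      v*A≡e = begin
        v * + A
          ≡⟨ completeSquare (+ A) (+ n) ε (+ X) (+ b) ⟩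
        ξ * ξ - ε * ε * (+ X * + X) + + b * + A
          ≡⟨ cong₂ (λ s t → ξ * ξ - s * (+ X * + X) + t) ε² B-exact-ℤ ⟩
        ξ * ξ - 1ℤ * (+ X * + X) + (+ X * + X + + c)
          ≡⟨ cancel (ξ * ξ) (+ X * + X) (+ c) ⟩
        e ∎
        where
        open ≡-Reasoning
        completeSquare : ∀ A n ε X b → (+ 4 * n * (A * n + ε * X) + b) * A ≡
          (+ 2 * A * n + ε * X) * (+ 2 * A * n + ε * X) - ε * ε * (X * X) + b * A
        completeSquare = ℤ-Solver.solve-∀
        cancel : ∀ s t c → s - 1ℤ * t + (t + c) ≡ s + c
        cancel = ℤ-Solver.solve-∀

      -- For negative `ε` the sign is not visible term by term; it comes from `v * A` being a square
      -- plus `c`, with `A` positive.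
      0≤v : 0ℤ ℤ.≤ v
      0≤v = ℤ.*-cancelʳ-≤-pos 0ℤ v (+ A) {{ℤ.positive (ℤ.+<+ (ℕ.>-nonZero⁻¹ A))}} (begin
        0ℤ * + A   ≡⟨ ℤ.*-zeroˡ (+ A) ⟩
        0ℤ         ≤⟨ ℤ.+-mono-≤ (0≤i² ξ) (+≤+ z≤n) ⟩
        e          ≡⟨ v*A≡e ⟨
        v * + A    ∎)
        where open ℤ.≤-Reasoning

      v≡e/A : v / 1 ≡ e / A
      v≡e/A = i≡j*n⇒j/1≡i/n e v A v*A≡e

    𝓑-poly≈quadratic : 𝓑-poly c A A∈𝓓 ε ≈ₚ quadratic (+ 4 * + A) (+ 4 * (ε * + X)) (+ b)
    𝓑-poly≈quadratic = expand (+ A) (ε * + X) (+ b)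
      where
      expand : ∀ a x b → const (+ 4) *ₚ indet *ₚ (const a *ₚ indet +ₚ const x) +ₚ const b ≈ₚ
        quadratic (+ 4 * a) (+ 4 * x) b
      expand a x b 0 = lemma a x b
        where
        lemma : ∀ a x b → 0ℤ * (a * 0ℤ + 0ℤ + x) + 0ℤ + b ≡ b
        lemma = ℤ-Solver.solve-∀
      expand a x b 1 = lemma a x
        where
        lemma : ∀ a x → 0ℤ * (a * 1ℤ) + (+ 4 * (a * 0ℤ + 0ℤ + x) + 0ℤ) ≡ + 4 * x
        lemma = ℤ-Solver.solve-∀
      expand a x b 2 = cong (+ 4 *_) (ℤ.*-identityʳ a)
      expand a x b (suc (suc (suc k))) = refl

    discriminant<0 : .{{NonZero c}} →
      + 4 * (ε * + X) * (+ 4 * (ε * + X)) - + 4 * (+ 4 * + A) * + b < 0ℤ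
    discriminant<0 = subst (_< 0ℤ) (sym disc≡) (negative c)
      where
      negative : ∀ c .{{_ : NonZero c}} → - (+ 16 * + c) < 0ℤ
      negative (suc _) = -<+
      regroup : ∀ ε X A b → + 4 * (ε * X) * (+ 4 * (ε * X)) - + 4 * (+ 4 * A) * b ≡
        + 16 * (ε * ε * (X * X)) - + 16 * (b * A)
      regroup = ℤ-Solver.solve-∀
      cancel : ∀ s c → + 16 * (1ℤ * s) - + 16 * (s + c) ≡ - (+ 16 * c)
      cancel = ℤ-Solver.solve-∀
      disc≡ : + 4 * (ε * + X) * (+ 4 * (ε * + X)) - + 4 * (+ 4 * + A) * + b ≡ - (+ 16 * + c)
      disc≡ = trans (regroup ε (+ X) (+ A) (+ b))
        (trans (cong₂ (λ s t → + 16 * (s * (+ X * + X)) - + 16 * t) ε² B-exact-ℤ)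
          (cancel (+ X * + X) (+ c)))

    primitive⇒gcd≡1 : Primitive (+ 4 * + A) (+ 4 * (ε * + X)) (+ b) → gcd A (gcd X b) ≡ 1
    primitive⇒gcd≡1 prim = ℕ.∣1⇒≡1 (∣⇒∣ᵤ {+ gcd A (gcd X b)} {1ℤ} (prim
      (∣n⇒∣m*n (+ 4) (∣ᵤ⇒∣ (gcd[m,n]∣m A (gcd X b))))
      (∣n⇒∣m*n (+ 4) (∣n⇒∣m*n ε (∣ᵤ⇒∣ (ℕ.∣-trans (gcd[m,n]∣n A (gcd X b)) (gcd[m,n]∣m X b)))))
      (∣ᵤ⇒∣ (ℕ.∣-trans (gcd[m,n]∣n A (gcd X b)) (gcd[m,n]∣n X b)))))

    -- A divisor `g` of `b` divides the odd number `X² + c`, so the factors 4 can be cancelled.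
    gcd≡1⇒primitive : gcd A (gcd X b) ≡ 1 → Primitive (+ 4 * + A) (+ 4 * (ε * + X)) (+ b)
    gcd≡1⇒primitive gcd≡1 {g} g∣4A g∣4εX g∣b = ∣ᵤ⇒∣ (subst (ℤ.∣ g ∣ ℕ.∣_) gcd≡1
      (gcd-greatest (∣⇒∣ᵤ g∣A) (gcd-greatest (∣⇒∣ᵤ g∣X) (∣⇒∣ᵤ g∣b))))
      where
      g∣X²+c : g ∣ + X * + X + + c
      g∣X²+c = subst (g ∣_) B-exact-ℤ (∣m⇒∣m*n (+ A) g∣b)
      g∣A : g ∣ + A
      g∣A = odd-cancel-4 odd-X²+c g∣X²+c g∣4A
      g∣X : g ∣ + X
      -- Multiplying by `ε` once more removes it, as `ε` is its own inverse.
      g∣X = subst (g ∣_)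
        (trans (sym (ℤ.*-assoc ε ε (+ X))) (trans (cong (_* + X) ε²) (ℤ.*-identityˡ (+ X))))
        (∣n⇒∣m*n ε (odd-cancel-4 odd-X²+c g∣X²+c g∣4εX))

    irreducible⇔gcd≡1 : .{{NonZero c}} → Irreducible (𝓑-poly c A A∈𝓓 ε) ⇔ gcd A (gcd X b) ≡ 1
    irreducible⇔gcd≡1 = mk⇔
      (primitive⇒gcd≡1 ∘ irreducible⇒primitive f f≈ (leading≢0 f f≈ discriminant<0))
      (primitive⇒irreducible f f≈ discriminant<0 ∘ gcd≡1⇒primitive)
      where
      f = 𝓑-poly c A A∈𝓓 ε
      f≈ = 𝓑-poly≈quadratic

  -- If `A` is `ξ² + c`, then the absolute value of `ξ` is admissible, so minimality of `X` gives
  -- `b * A = X² + c ≤ A`. Positivity of `c` excludes `b = 0`.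
  A∈E⇒B≡1 : .{{NonZero c}} → + A ∈ E c → b ≡ 1
  A∈E⇒B≡1 (ξ , par , A≡) = ℕ.≤-antisym b≤1 (ℕ.n≢0⇒n>0 b≢0)
    where
    b≢0 : b ≢ 0
    b≢0 b≡0 = ℕ.≢-nonZero⁻¹ c (ℕ.m+n≡0⇒n≡0 (X ℕ.* X)
      (trans (sym (B-exact c A A∈𝓓)) (cong (ℕ._* A) b≡0)))
    bound : ∀ {m} → m ∈ Admissible c A → + A ≡ + (m ℕ.* m) + + c → X ℕ.* X ℕ.+ c ℕ.≤ A
    bound m-adm A≡m²+c = subst (X ℕ.* X ℕ.+ c ℕ.≤_) (sym (ℤ.+-injective A≡m²+c))
      (ℕ.+-monoˡ-≤ c (ℕ.*-mono-≤ X≤m X≤m))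
      where X≤m = proj₂ (X₀-isLeast c A A∈𝓓) m-adm
    X²+c≤A : ∀ ξ → ξ ≡ + c - 1ℤ [mod + 2 ] → + A ≡ ξ * ξ + + c → X ℕ.* X ℕ.+ c ℕ.≤ A
    X²+c≤A (+ n) par A≡ = bound (par , ∣-reflexive A≡)
      (trans A≡ (cong (_+ + c) (sym (ℤ.pos-* n n))))
    -- Matching `par` lets `admissible-exists` compute its witness, the absolute value of `ξ`; then
    -- `A≡` has the required form by computation.
    X²+c≤A ξ@(-[1+ _ ]) par@(divides _ _) A≡ =
      bound (proj₂ (admissible-exists c A (A≢0 , _ , (ξ , par , refl) , ∣-reflexive A≡))) A≡
    b≤1 : b ℕ.≤ 1
    b≤1 = ℕ.*-cancelʳ-≤ b 1 A (begin
      b ℕ.* A           ≡⟨ B-exact c A A∈𝓓 ⟩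
      X ℕ.* X ℕ.+ c     ≤⟨ X²+c≤A ξ par A≡ ⟩
      A                 ≡⟨ ℕ.*-identityˡ A ⟨
      1 ℕ.* A           ∎)
      where open ℕ.≤-Reasoning

proposition2p2 : (c : ℕ) .{{_ : NonZero c}} (A₁ : ℕ) (A₁∈𝓓 : A₁ ∈ 𝓓 c) →
    ((ε : ℤ) → ε ≡ 1ℤ ⊎ ε ≡ -1ℤ → 𝓑-prog c A₁ A₁∈𝓓 ε ⊆ 𝓑 c A₁ A₁∈𝓓)
    × ((+ A₁) ∈ E c → B c A₁ A₁∈𝓓 ≡ 1)
    × ((ε : ℤ) → ε ≡ 1ℤ ⊎ ε ≡ -1ℤ →
    Irreducible (𝓑-poly c A₁ A₁∈𝓓 ε) ⇔ (gcd A₁ (gcd (X₀ c A₁ A₁∈𝓓) (B c A₁ A₁∈𝓓)) ≡ 1))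
proposition2p2 c A₁ A₁∈𝓓 =
  progression⊆𝓑 c A₁ A₁∈𝓓 , A∈E⇒B≡1 c A₁ A₁∈𝓓 , λ ε ε≡±1 → irreducible⇔gcd≡1 c A₁ A₁∈𝓓 ε ε≡±1
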